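{- Let $P$ be a poset and let $\to$ be a total binary operation on $P$. Then $$x\to y=\max\{u\ge y: u\perp_y x\}\quad\text{for all }x,y\in P$$ (i.e. for all $x,y$ this maximum exists and equals $x\to y$) if and only if the following conditions hold for all $x,y,z\in P$: (1) if $x\le y$, then $y\to z\le x\to z$; (2) if $y\le x\le x\to y$, then $x\le y$; (3) if $z\le x$ and $x\perp_z y$, then $x\le y\to z$.
   Context: For elements of a poset $P$, $[p,q]=\{x: p\le x\le q\}$ (empty if $p\not\le q$). For $x,y,p\in P$, $x\perp_p y$ means $[p,x]\cap[p,y]\subseteq\{p\}$. Here $\max$ denotes the greatest element of a set. -}

module Defs where

open import Level using (Level; _⊔_)
open import Data.Product using (_×_)
open import Relation.Binary.Bundles using (Poset)
open import Relation.Unary using (Pred; _∈_; _∩_; _⊆_)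

module PosetNotions {c ℓ₁ ℓ₂ : Level} (P : Poset c ℓ₁ ℓ₂) where
  open Poset P using (Carrier; _≈_; _≤_)

  Interval : Carrier → Carrier → Pred Carrier ℓ₂
  Interval p q x = p ≤ x × x ≤ q

  -- Equality of elements of P is _≈_, so singletons are ≈-classes.
  Singleton : Carrier → Pred Carrier ℓ₁
  Singleton p x = x ≈ p

  _⊥[_]_ : Carrier → Carrier → Carrier → Set (c ⊔ ℓ₁ ⊔ ℓ₂)
  x ⊥[ p ] y = (Interval p x ∩ Interval p y) ⊆ Singleton p

  -- m is max S.  By antisymmetry such an m is unique up to _≈_, so this
  -- says both that max S exists and that it equals m.
  IsGreatest : ∀ {ℓ} → Pred Carrier ℓ → Carrier → Set (c ⊔ ℓ₂ ⊔ ℓ)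
  IsGreatest S m = m ∈ S × (∀ u → u ∈ S → u ≤ m)

  Candidates : Carrier → Carrier → Pred Carrier (c ⊔ ℓ₁ ⊔ ℓ₂)
  Candidates x y u = y ≤ u × u ⊥[ y ] x

{-# OPTIONS --safe #-}
module Submission where

open import Level using (Level)
open import Algebra.Core using (Op₂)
open import Data.Product using (_×_; _,_; proj₁; proj₂)
open import Function.Bundles using (_⇔_; mk⇔)
open import Relation.Binary.Bundles using (Poset)
open import Defs

-- Condition (3) says that `x ⟶ y` bounds all candidates from above, so the other two must express
-- that `x ⟶ y` is itself a candidate. Condition (2) tests orthogonality of `x ⟶ y` and `x` only at
-- the point `x`; antitonicity (1) carries the test to every `w ≤ x`. Conversely, shrinking `x`
-- enlarges the candidate set, so its maximum grows.

module _ {c ℓ₁ ℓ₂ : Level} (P : Poset c ℓ₁ ℓ₂) where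
  open Poset P using (_≤_; trans; antisym)
  open PosetNotions P

  ⊥-antitoneʳ : ∀ {u x y p} → x ≤ y → u ⊥[ p ] y → u ⊥[ p ] x
  ⊥-antitoneʳ x≤y u⊥y (p≤w≤u , p≤w , w≤x) = u⊥y (p≤w≤u , p≤w , trans w≤x x≤y)

  ⊥-base : ∀ p x → p ⊥[ p ] x
  ⊥-base p x ((p≤w , w≤p) , _) = antisym w≤p p≤w

theorem5p3 : ∀ {c ℓ₁ ℓ₂ : Level} (P : Poset c ℓ₁ ℓ₂) (_⟶_ : Op₂ (Poset.Carrier P)) →
    let open Poset P using (_≤_)
        open PosetNotions P
    in
    (∀ x y → IsGreatest (Candidates x y) (x ⟶ y))
      ⇔
    ( (∀ x y z → x ≤ y → (y ⟶ z) ≤ (x ⟶ z))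
    × (∀ x y → y ≤ x → x ≤ (x ⟶ y) → x ≤ y)
    × (∀ x y z → z ≤ x → x ⊥[ z ] y → x ≤ (y ⟶ z)) )
theorem5p3 P _⟶_ = mk⇔ only-if if
  where
  open Poset P using (_≤_; refl; reflexive; trans; antisym)
  open PosetNotions P

  Conditions : Set _
  Conditions =
      (∀ x y z → x ≤ y → (y ⟶ z) ≤ (x ⟶ z))
    × (∀ x y → y ≤ x → x ≤ (x ⟶ y) → x ≤ y)
    × (∀ x y z → z ≤ x → x ⊥[ z ] y → x ≤ (y ⟶ z))

  only-if : (∀ x y → IsGreatest (Candidates x y) (x ⟶ y)) → Conditions
  only-if greatest = antitone , collapse , λ x y z z≤x x⊥y → proj₂ (greatest y z) x (z≤x , x⊥y)
    where
    antitone : ∀ x y z → x ≤ y → (y ⟶ z) ≤ (x ⟶ z)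
    antitone x y z x≤y with ((z≤y⟶z , y⟶z⊥y) , _) ← greatest y z =
      proj₂ (greatest x z) (y ⟶ z) (z≤y⟶z , λ {w} → ⊥-antitoneʳ P x≤y y⟶z⊥y {w})

    collapse : ∀ x y → y ≤ x → x ≤ (x ⟶ y) → x ≤ y
    collapse x y y≤x x≤x⟶y with ((_ , x⟶y⊥x) , _) ← greatest x y =
      -- `x` lies in both `[y, x ⟶ y]` and `[y, x]`, so orthogonality forces `x ≈ y`.
      reflexive (x⟶y⊥x ((y≤x , x≤x⟶y) , (y≤x , refl)))

  if : Conditions → ∀ x y → IsGreatest (Candidates x y) (x ⟶ y)
  if (antitone , collapse , maximal) x y =
    -- `y` is always a candidate, since `[y, y]` contains only `y`; hence `y ≤ x ⟶ y`.
    (maximal y x y refl (⊥-base P y x) , x⟶y⊥x) , λ u (y≤u , u⊥x) → maximal u x y y≤u u⊥x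
    where
    -- For w ≤ x, antitonicity turns w ≤ x ⟶ y into w ≤ w ⟶ y, to which (2) applies.
    x⟶y⊥x : (x ⟶ y) ⊥[ y ] x
    x⟶y⊥x {w} ((y≤w , w≤x⟶y) , (_ , w≤x)) =
      antisym (collapse w y y≤w (trans w≤x⟶y (antitone w x y w≤x))) y≤w
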